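{- Let $n$ and $k$ be positive integers with $n\leq k\leq\binom{n}{2}+n$. Then, for integers $t$ with $2\leq t\leq n-1$, \[ g(n,k)= \begin{cases} k-n+t & \text{if } \binom{n-t}{2}+t(n-t-1)+n\leq k\leq \binom{n-t}{2}+t(n-t)+n-2,\\[2pt] k-n+t-1 & \text{if } k=\binom{n-t}{2}+t(n-t)+n-1,\\[2pt] \binom{n}{2}-1 & \text{if } k=\binom{n}{2}+n-1,\\[2pt] \binom{n}{2} & \text{if } k=\binom{n}{2}+n. \end{cases} \]
   Context: All graphs are finite, simple and undirected; $\binom{1}{2}=0$. A graph is total-colored if all its edges and all its vertices are assigned colors. A path in a total-colored graph is a total monochromatic path if all its edges and all its internal vertices have the same color. A total-coloring of a connected graph $G$ is a TMC-coloring if any two vertices of $G$ are joined by a total monochromatic path. The total monochromatic connection number $tmc(G)$ of a connected graph $G$ is the maximum number of colors used in a TMC-coloring of $G$. For positive integers $n,k$, $g(n,k)$ denotes the maximum integer such that every connected graph $G$ of order $n$ with $|E(G)|\leq g(n,k)$ satisfies $tmc(G)\leq k$.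
   Formalization: g(n,k) is taken as the maximum among the possible edge numbers 0,…,C(n,2); without this bound the maximum does not exist for k = C(n,2)+n, where every integer qualifies. For smaller k the bound changes nothing. -}

module Defs where

open import Data.Nat using (ℕ; zero; suc; _+_; _*_; _∸_; _≤_; _<_)
open import Data.Nat.Combinatorics using (_C_)
open import Data.Bool using (Bool; true; false; _∧_; if_then_else_)
open import Data.Nat using (_<ᵇ_)
open import Data.Fin using (Fin; toℕ; fromℕ; inject₁)
open import Data.List using (map; allFin)
open import Data.Nat.ListAction using (sum)
open import Data.Product using (Σ; ∃; ∃-syntax; _×_)
open import Data.Sum using (_⊎_)
open import Function.Definitions using (Injective)
open import Relation.Binary.PropositionalEquality using (_≡_)

record Graph (n : ℕ) : Set where
  field
    adj    : Fin n → Fin n → Bool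
    sym    : ∀ i j → adj i j ≡ adj j i
    irrefl : ∀ i → adj i i ≡ false
open Graph public

edgeCount : ∀ {n} → Graph n → ℕ
edgeCount {n} G =
  sum (map (λ i → sum (map (λ j → if (toℕ i <ᵇ toℕ j) ∧ adj G i j then 1 else 0)
                           (allFin n)))
           (allFin n))

record Path {n : ℕ} (G : Graph n) (u v : Fin n) : Set where
  field
    len      : ℕ
    verts    : Fin (suc len) → Fin n
    start    : verts Fin.zero ≡ u
    end      : verts (fromℕ len) ≡ v
    distinct : Injective _≡_ _≡_ verts
    adjacent : ∀ (i : Fin len) → adj G (verts (inject₁ i)) (verts (Fin.suc i)) ≡ true
open Path public

Connected : ∀ {n} → Graph n → Set
Connected G = ∀ u v → Path G u v

record TotalColoring {n : ℕ} (G : Graph n) (c : ℕ) : Set where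
  field
    vcol     : Fin n → Fin c
    ecol     : Fin n → Fin n → Fin c
    ecol-sym : ∀ i j → adj G i j ≡ true → ecol i j ≡ ecol j i
    allUsed  : ∀ (a : Fin c) →
               (∃[ v ] vcol v ≡ a) ⊎ (∃[ i ] ∃[ j ] (adj G i j ≡ true × ecol i j ≡ a))
open TotalColoring public

TotalMonochromatic : ∀ {n c} {G : Graph n} {u v} → TotalColoring G c → Path G u v → Set
TotalMonochromatic {c = c} col P =
  ∃[ a ] ((∀ (i : Fin (len P)) →
             ecol col (verts P (inject₁ i)) (verts P (Fin.suc i)) ≡ a)
         × (∀ (i : Fin (suc (len P))) → 0 < toℕ i → toℕ i < len P →
             vcol col (verts P i) ≡ a))

IsTMC : ∀ {n c} {G : Graph n} → TotalColoring G c → Set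
IsTMC {G = G} col = ∀ u v → Σ (Path G u v) (TotalMonochromatic col)

-- tmc(G) ≤ k  (tmc(G) is the maximum number of colors of a TMC-coloring)
TmcAtMost : ∀ {n} → Graph n → ℕ → Set
TmcAtMost G k = ∀ c (col : TotalColoring G c) → IsTMC col → c ≤ k

Good : ℕ → ℕ → ℕ → Set
Good n k m = ∀ (G : Graph n) → Connected G → edgeCount G ≤ m → TmcAtMost G k

-- g(n,k) = m : m is the maximum integer (in the range 0..C(n,2), the
-- possible edge counts) such that Good n k m.
IsG : ℕ → ℕ → ℕ → Set
IsG n k m = m ≤ n C 2 × Good n k m × (∀ m' → m' ≤ n C 2 → Good n k m' → m' ≤ m)

{-# OPTIONS --safe #-}

-- Upper bound on the number c of colours of a TMC-coloring of G with m edges: call an edge shared if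
-- some vertex has its colour, and let w be the number of shared edges. Sending each colour to a vertex
-- or to a non-shared edge carrying it gives c + w ≤ n + m. A non-adjacent pair is joined by a path in
-- one colour, all of whose edges are shared as it has an internal vertex. Choosing the path shortest in
-- its colour, the ordered pair (first edge, last edge) determines the ordered pair of its ends, so there
-- are at most w C 2 non-adjacent pairs. Hence c + t ≤ n + m as soon as more than (t ∸ 1) C 2 pairs are
-- non-adjacent.
--
-- This is sharp: delete d ≤ t C 2 edges of K_n inside a set T of t vertices, give one vertex outside T
-- and its edges to T a common colour, and give all other vertices and edges distinct colours of their own.
module Submission where

open import Defs hiding (sym)
open import Data.Nat using (ℕ; zero; suc; _+_; _*_; _∸_; _≤_; _<_; z≤n; s≤s; s≤s⁻¹; _<ᵇ_; _≤?_)
open import Data.Nat.Properties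
open import Data.Nat.Combinatorics using (_C_; nC1≡n; nCk+nC[k+1]≡[n+1]C[k+1])
open import Data.Nat.ListAction using (sum)
open import Data.Nat.Tactic.RingSolver using (solve-∀)
open import Data.Bool as Bool using (true; false; _∧_; if_then_else_)
open import Data.Bool.Properties using (T-≡)
open import Data.Empty using (⊥)
open import Data.Fin as Fin using (Fin; toℕ; fromℕ; inject₁; _↑ˡ_; _↑ʳ_; splitAt)
open import Data.Fin.Properties as Fin using (injective⇒≤; any?; splitAt⁻¹-↑ˡ; splitAt⁻¹-↑ʳ)
open import Data.List using (List; []; _∷_; _++_; map; length; lookup; filter; allFin; cartesianProduct; take)
open import Data.List.Properties using (length-++; length-map; length-tabulate; length-take; filter-++; take++drop≡id)
import Data.List.Membership.DecPropositional as DecMembership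
open import Data.List.Membership.Propositional using (_∈_; _∉_)
open import Data.List.Membership.Propositional.Properties
  using (∈-lookup; ∈-++⁺ˡ; ∈-++⁺ʳ; ∈-++⁻; ∈-map⁺; ∈-map⁻; ∈-filter⁺; ∈-filter⁻; ∈-allFin; ∈-cartesianProduct⁺)
open import Data.List.Membership.Setoid.Properties using (index-injective)
open import Data.List.Relation.Unary.All as All using ([]; _∷_)
open import Data.List.Relation.Unary.AllPairs as AllPairs using (AllPairs; []; _∷_)
import Data.List.Relation.Unary.AllPairs.Properties as AllPairs
open import Data.List.Relation.Unary.Any using (here; there; index)
open import Data.List.Relation.Unary.Any.Properties using (lookup-index)
open import Data.List.Relation.Unary.Unique.Propositional using (Unique)
import Data.List.Relation.Unary.Unique.Propositional.Properties as Unique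
open import Data.Product using (Σ; ∃; ∃-syntax; _×_; _,_; proj₁; proj₂; swap)
open import Data.Product.Properties using (,-injectiveʳ; ≡-dec)
open import Data.Sum using (_⊎_; inj₁; inj₂)
open import Data.Sum.Properties using (inj₁-injective; inj₂-injective)
open import Function using (_∘_; id; Injective; Equivalence)
open import Relation.Binary using (tri<; tri≈; tri>)
open import Relation.Binary.PropositionalEquality
  using (_≡_; _≢_; refl; sym; trans; cong; cong₂; subst; setoid; module ≡-Reasoning)
open import Relation.Nullary using (¬_; Dec; yes; no; does; contradiction; ¬?; _×-dec_)
open import Relation.Nullary.Decidable using (dec-true; dec-false)
open import Relation.Unary using (Decidable)

-- Counting in lists: injections, complements, unordered pairs.

module _ {A : Set} where

  lookup-injective : {xs : List A} → Unique xs → Injective _≡_ _≡_ (lookup xs)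
  lookup-injective (x∉ ∷ u) {Fin.zero}  {Fin.zero}  eq = refl
  lookup-injective (x∉ ∷ u) {Fin.zero}  {Fin.suc j} eq = contradiction eq (All.lookup x∉ (∈-lookup j))
  lookup-injective (x∉ ∷ u) {Fin.suc i} {Fin.zero}  eq = contradiction (sym eq) (All.lookup x∉ (∈-lookup i))
  lookup-injective (x∉ ∷ u) {Fin.suc i} {Fin.suc j} eq = cong Fin.suc (lookup-injective u eq)

  -- Sending a position of `xs` to the position in `ys` of its chosen partner is injective. With a
  -- relation in place of a function, partners need only exist, as is the case for the carrier of a
  -- colour and for a walk between two vertices.
  injectiveRel⇒length≤ : {B : Set} {R : A → B → Set} {xs : List A} {ys : List B} → Unique xs →
    (∀ {x} → x ∈ xs → ∃[ y ] (y ∈ ys × R x y)) →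
    (∀ {x x′ y} → R x y → R x′ y → x ≡ x′) → length xs ≤ length ys
  injectiveRel⇒length≤ {B} {R} {xs} {ys} uxs total inj = injective⇒≤ {f = f} f-injective
    where
    image : (i : Fin (length xs)) → ∃[ y ] (y ∈ ys × R (lookup xs i) y)
    image i = total (∈-lookup i)
    f : Fin (length xs) → Fin (length ys)
    f i = index (proj₁ (proj₂ (image i)))
    f-injective : Injective _≡_ _≡_ f
    f-injective {i} {j} eq = lookup-injective uxs (inj (proj₂ (proj₂ (image i)))
      (subst (R (lookup xs j)) (sym y≡y′) (proj₂ (proj₂ (image j)))))
      where
      y≡y′ : proj₁ (image i) ≡ proj₁ (image j)
      y≡y′ = index-injective (setoid B) (proj₁ (proj₂ (image i))) (proj₁ (proj₂ (image j))) eq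

  ⊆⇒length≤ : {xs ys : List A} → Unique xs → (∀ {x} → x ∈ xs → x ∈ ys) → length xs ≤ length ys
  ⊆⇒length≤ uxs ⊆ = injectiveRel⇒length≤ {R = _≡_} uxs (λ {x} x∈ → x , ⊆ x∈ , refl) (λ { refl refl → refl })

  length-filter-complement : {P : A → Set} (P? : Decidable P) (xs : List A) →
    length (filter P? xs) + length (filter (¬? ∘ P?) xs) ≡ length xs
  length-filter-complement P? []       = refl
  length-filter-complement P? (x ∷ xs) with P? x
  ... | yes _ = cong suc (length-filter-complement P? xs)
  ... | no  _ = trans (+-suc _ _) (cong suc (length-filter-complement P? xs))

  pairs : List A → List (A × A)
  pairs []       = []
  pairs (x ∷ xs) = map (x ,_) xs ++ pairs xs

  length-pairs : (xs : List A) → length (pairs xs) ≡ length xs C 2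
  length-pairs []       = refl
  length-pairs (x ∷ xs) =
    trans (length-++ (map (x ,_) xs))
      (trans (cong₂ _+_ (trans (length-map (x ,_) xs) (sym (nC1≡n (length xs)))) (length-pairs xs))
             (nCk+nC[k+1]≡[n+1]C[k+1] (length xs) 1))

  ∈-pairs⁻ : ∀ {R : A → A → Set} {i j} {xs : List A} → AllPairs R xs → (i , j) ∈ pairs xs → i ∈ xs × j ∈ xs × R i j
  ∈-pairs⁻ {xs = x ∷ xs} (x< ∷ s) ij∈ with ∈-++⁻ (map (x ,_) xs) ij∈
  ... | inj₂ later with i∈ , j∈ , r ← ∈-pairs⁻ s later = there i∈ , there j∈ , r
  ... | inj₁ first with _ , j∈ , refl ← ∈-map⁻ (x ,_) first = here refl , there j∈ , All.lookup x< j∈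

  ∈-pairs⁺ : ∀ {i j} {xs : List A} → i ≢ j → i ∈ xs → j ∈ xs → (i , j) ∈ pairs xs ⊎ (j , i) ∈ pairs xs
  ∈-pairs⁺ i≢j (here refl) (here refl) = contradiction refl i≢j
  ∈-pairs⁺ i≢j (here refl) (there j∈)  = inj₁ (∈-++⁺ˡ (∈-map⁺ _ j∈))
  ∈-pairs⁺ i≢j (there i∈)  (here refl) = inj₂ (∈-++⁺ˡ (∈-map⁺ _ i∈))
  ∈-pairs⁺ {xs = x ∷ xs} i≢j (there i∈) (there j∈) with ∈-pairs⁺ i≢j i∈ j∈
  ... | inj₁ p = inj₁ (∈-++⁺ʳ (map (x ,_) xs) p)
  ... | inj₂ p = inj₂ (∈-++⁺ʳ (map (x ,_) xs) p)

  pairs-unique : {xs : List A} → Unique xs → Unique (pairs xs)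
  pairs-unique []                     = []
  pairs-unique {xs = x ∷ xs} (x∉ ∷ u) =
    Unique.++⁺ (Unique.map⁺ ,-injectiveʳ u) (pairs-unique u) disjoint
    where
    disjoint : ∀ {p} → ¬ (p ∈ map (x ,_) xs × p ∈ pairs xs)
    disjoint (p∈ , q∈) with _ , _ , refl ← ∈-map⁻ (x ,_) p∈ =
      All.lookup x∉ (proj₁ (∈-pairs⁻ u q∈)) refl

-- Unordered pairs of vertices.

allPairs : ∀ n → List (Fin n × Fin n)
allPairs n = pairs (allFin n)

allFin-sorted : ∀ n → AllPairs Fin._<_ (allFin n)
allFin-sorted n = AllPairs.tabulate⁺-< id

length-allPairs : ∀ n → length (allPairs n) ≡ n C 2
length-allPairs n = trans (length-pairs (allFin n)) (cong (_C 2) (length-tabulate {n = n} id))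

allPairs-unique : ∀ n → Unique (allPairs n)
allPairs-unique n = pairs-unique (Unique.allFin⁺ n)

∈-allPairs⁻ : ∀ {n} {i j : Fin n} → (i , j) ∈ allPairs n → i Fin.< j
∈-allPairs⁻ {n} p = proj₂ (proj₂ (∈-pairs⁻ (allFin-sorted n) p))

∈-allPairs⁺ : ∀ {n} {i j : Fin n} → i Fin.< j → (i , j) ∈ allPairs n
∈-allPairs⁺ {n} {i} {j} i<j with ∈-pairs⁺ (Fin.<⇒≢ i<j) (∈-allFin i) (∈-allFin j)
... | inj₁ p = p
... | inj₂ p = contradiction (∈-allPairs⁻ p) (Fin.<-asym i<j)

-- Normal form of an unordered pair: the smaller end comes first, so an undirected edge is a single
-- member of `allPairs n`.
edge : ∀ {n} → Fin n → Fin n → Fin n × Fin n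
edge i j with i Fin.<? j
... | yes _ = i , j
... | no  _ = j , i

edge-cases : ∀ {n} (i j : Fin n) → edge i j ≡ (i , j) ⊎ edge i j ≡ (j , i)
edge-cases i j with i Fin.<? j
... | yes _ = inj₁ refl
... | no  _ = inj₂ refl

edge-< : ∀ {n} {i j : Fin n} → i Fin.< j → edge i j ≡ (i , j)
edge-< {i = i} {j} i<j with i Fin.<? j
... | yes _   = refl
... | no  i≮j = contradiction i<j i≮j

edge-comm : ∀ {n} (i j : Fin n) → edge i j ≡ edge j i
edge-comm i j with i Fin.<? j | j Fin.<? i
... | yes p | yes q = contradiction q (Fin.<-asym p)
... | yes _ | no  _ = refl
... | no  _ | yes _ = refl
... | no  p | no  q with Fin.<-cmp i j
...   | tri< r _ _    = contradiction r p
...   | tri≈ _ refl _ = refl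
...   | tri> _ _ r    = contradiction r q

edge∈allPairs : ∀ {n} {i j : Fin n} → i ≢ j → edge i j ∈ allPairs n
edge∈allPairs {i = i} {j} i≢j with Fin.<-cmp i j
... | tri< i<j _ _ = subst (_∈ _) (sym (edge-< i<j)) (∈-allPairs⁺ i<j)
... | tri≈ _ eq _  = contradiction eq i≢j
... | tri> _ _ j<i = subst (_∈ _) (sym (trans (edge-comm i j) (edge-< j<i))) (∈-allPairs⁺ j<i)

edge-injective : ∀ {n} {i j k l : Fin n} → edge i j ≡ edge k l → (i ≡ k × j ≡ l) ⊎ (i ≡ l × j ≡ k)
edge-injective {i = i} {j} {k} {l} eq with edge-cases i j | edge-cases k l
... | inj₁ p | inj₁ q with refl ← trans (sym p) (trans eq q) = inj₁ (refl , refl)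
... | inj₁ p | inj₂ q with refl ← trans (sym p) (trans eq q) = inj₂ (refl , refl)
... | inj₂ p | inj₁ q with refl ← trans (sym p) (trans eq q) = inj₂ (refl , refl)
... | inj₂ p | inj₂ q with refl ← trans (sym p) (trans eq q) = inj₁ (refl , refl)

-- Edges and non-edges of a graph as lists.

module _ {n : ℕ} (G : Graph n) where

  Adjacent : Fin n × Fin n → Set
  Adjacent (i , j) = adj G i j ≡ true

  adjacent? : Decidable Adjacent
  adjacent? (i , j) = adj G i j Bool.≟ true

  edges : List (Fin n × Fin n)
  edges = filter adjacent? (allPairs n)

  nonEdges : List (Fin n × Fin n)
  nonEdges = filter (¬? ∘ adjacent?) (allPairs n)

  adjacent⇒≢ : ∀ {i j} → adj G i j ≡ true → i ≢ j
  adjacent⇒≢ {i} a refl with () ← trans (sym a) (irrefl G i)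

  adjacent-edge : ∀ {i j} → adj G i j ≡ true → Adjacent (edge i j)
  adjacent-edge {i} {j} a with edge-cases i j
  ... | inj₁ eq rewrite eq = a
  ... | inj₂ eq rewrite eq = trans (Graph.sym G j i) a

  edge∈edges : ∀ {i j} → adj G i j ≡ true → edge i j ∈ edges
  edge∈edges a = ∈-filter⁺ adjacent? (edge∈allPairs (adjacent⇒≢ a)) (adjacent-edge a)

  private
    -- The Boolean is the one tested inside `edgeCount`, so the double sum becomes the length of a
    -- filtered product list, which is then compared with `edges` by mutual inclusion.
    oriented? : (p : Fin n × Fin n) →
      Dec ((toℕ (proj₁ p) <ᵇ toℕ (proj₂ p)) ∧ adj G (proj₁ p) (proj₂ p) ≡ true)
    oriented? p = _ Bool.≟ true

    length-row : ∀ i (js : List (Fin n)) →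
      length (filter oriented? (map (i ,_) js)) ≡
      sum (map (λ j → if (toℕ i <ᵇ toℕ j) ∧ adj G i j then 1 else 0) js)
    length-row i []       = refl
    length-row i (j ∷ js) with (toℕ i <ᵇ toℕ j) ∧ adj G i j
    ... | true  = cong suc (length-row i js)
    ... | false = length-row i js

    length-rows : ∀ (is js : List (Fin n)) →
      length (filter oriented? (cartesianProduct is js)) ≡
      sum (map (λ i → sum (map (λ j → if (toℕ i <ᵇ toℕ j) ∧ adj G i j then 1 else 0) js)) is)
    length-rows []       js = refl
    length-rows (i ∷ is) js = trans (cong length (filter-++ oriented? (map (i ,_) js) _))
      (trans (length-++ (filter oriented? (map (i ,_) js))) (cong₂ _+_ (length-row i js) (length-rows is js)))

    ∧-true : ∀ {a b} → a ∧ b ≡ true → a ≡ true × b ≡ true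
    ∧-true {true} eq = refl , eq

  edgeCount≡length : edgeCount G ≡ length edges
  edgeCount≡length = trans (sym (length-rows (allFin n) (allFin n)))
    (≤-antisym (⊆⇒length≤ (Unique.filter⁺ oriented? (Unique.cartesianProduct⁺ (Unique.allFin⁺ n) (Unique.allFin⁺ n))) to)
               (⊆⇒length≤ (Unique.filter⁺ adjacent? (allPairs-unique n)) from))
    where
    to : ∀ {p} → p ∈ filter oriented? (cartesianProduct (allFin n) (allFin n)) → p ∈ edges
    to {i , j} p∈ with i<j , a ← ∧-true (proj₂ (∈-filter⁻ oriented? {xs = cartesianProduct (allFin n) (allFin n)} p∈)) =
      ∈-filter⁺ adjacent? (∈-allPairs⁺ (<ᵇ⇒< (toℕ i) (toℕ j) (Equivalence.from T-≡ i<j))) a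
    from : ∀ {p} → p ∈ edges → p ∈ filter oriented? (cartesianProduct (allFin n) (allFin n))
    from {i , j} p∈ with p∈all , a ← ∈-filter⁻ adjacent? p∈ =
      ∈-filter⁺ oriented? (∈-cartesianProduct⁺ (∈-allFin i) (∈-allFin j))
        (cong₂ _∧_ (Equivalence.to T-≡ (<⇒<ᵇ (∈-allPairs⁻ p∈all))) a)

  edgeCount+nonEdges : edgeCount G + length nonEdges ≡ n C 2
  edgeCount+nonEdges = trans (cong (_+ length nonEdges) edgeCount≡length)
    (trans (length-filter-complement adjacent? (allPairs n)) (length-allPairs n))

  edges-unique : Unique edges
  edges-unique = Unique.filter⁺ adjacent? (allPairs-unique n)

-- Least witnesses, and the size of a product of lists.

Minimal : (ℕ → Set) → ℕ → Set
Minimal P m = P m × (∀ {l} → P l → m ≤ l)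

minimum : {P : ℕ → Set} → Decidable P → ∀ {l} → P l → ∃ (Minimal P)
minimum {P} P? {l} p with search (suc l)
  where
  -- Going up through 0, 1, 2, ..., the first witness met is the least; reaching `suc l` without one
  -- contradicts `p`.
  search : ∀ b → ∃ (Minimal P) ⊎ (∀ {l} → P l → b ≤ l)
  search zero    = inj₂ (λ _ → z≤n)
  search (suc b) with search b
  ... | inj₁ m = inj₁ m
  ... | inj₂ below with P? b
  ...   | yes p = inj₁ (b , p , below)
  ...   | no ¬p = inj₂ (λ {l} q → ≤∧≢⇒< (below q) (λ { refl → ¬p q }))
... | inj₁ m     = m
... | inj₂ below = contradiction (below p) (<-irrefl refl)

length-cartesianProduct : {A B : Set} (xs : List A) (ys : List B) →
  length (cartesianProduct xs ys) ≡ length xs * length ys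
length-cartesianProduct []       ys = refl
length-cartesianProduct (x ∷ xs) ys = trans (length-++ (map (x ,_) ys))
  (cong₂ _+_ (length-map (x ,_) ys) (length-cartesianProduct xs ys))

-- Upper bound: monochromatic walks and their end edges.

module _ {n c : ℕ} {G : Graph n} (col : TotalColoring G c) where

  Step : Fin c → Fin n → Fin n → Set
  Step a u v = adj G u v ≡ true × ecol col u v ≡ a

  -- Vertices may repeat: walks can be cut with no distinctness to maintain, and each length is
  -- decidable, so a shortest one exists. Length 1 is a case of its own because only internal
  -- vertices must have colour `a`.
  Walk : Fin c → ℕ → Fin n → Fin n → Set
  Walk a zero          u v = u ≡ v
  Walk a (suc zero)    u v = Step a u v
  Walk a (suc (suc l)) u v = ∃[ x ] (Step a u x × vcol col x ≡ a × Walk a (suc l) x v)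

  step? : ∀ a u v → Dec (Step a u v)
  step? a u v = (adj G u v Bool.≟ true) ×-dec (ecol col u v Fin.≟ a)

  walk? : ∀ a l u v → Dec (Walk a l u v)
  walk? a zero          u v = u Fin.≟ v
  walk? a (suc zero)    u v = step? a u v
  walk? a (suc (suc l)) u v = any? (λ x → step? a u x ×-dec (vcol col x Fin.≟ a) ×-dec walk? a (suc l) x v)

  walk-along : ∀ a l (f : Fin (suc l) → Fin n) →
    (∀ i → Step a (f (inject₁ i)) (f (Fin.suc i))) →
    (∀ i → 0 < toℕ i → toℕ i < l → vcol col (f i) ≡ a) →
    Walk a l (f Fin.zero) (f (fromℕ l))
  walk-along a zero          f step internal = refl
  walk-along a (suc zero)    f step internal = step Fin.zero
  walk-along a (suc (suc l)) f step internal =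
    f (Fin.suc Fin.zero) , step Fin.zero , internal (Fin.suc Fin.zero) (s≤s z≤n) (s≤s (s≤s z≤n)) ,
    walk-along a (suc l) (f ∘ Fin.suc) (step ∘ Fin.suc) (λ i _ i<l → internal (Fin.suc i) (s≤s z≤n) (s≤s i<l))

  IsTMC⇒walk : IsTMC col → ∀ u v → ∃[ a ] ∃[ l ] Walk a l u v
  IsTMC⇒walk tmc u v with P , a , es , vs ← tmc u v =
    a , len P , subst (λ x → Walk a (len P) x v) (start P)
      (subst (Walk a (len P) _) (end P) (walk-along a (len P) (verts P) (λ i → adjacent P i , es i) vs))

  -- Splits a walk of length `l + 2` at its second vertex `x` and its last but one `y`, which
  -- coincide when `l` is 0. The colour of `x` alone shows both end edges to be shared, and the
  -- three shorter walks serve the exchange argument in `joins-injective`.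
  record Ends (a : Fin c) (l : ℕ) (u v : Fin n) : Set where
    constructor ends
    field
      {x y}     : Fin n
      first     : Step a u x
      last      : Step a y v
      x-colored : vcol col x ≡ a
      dropLast  : Walk a (suc l) u y
      dropFirst : Walk a (suc l) x v
      inner     : Walk a l x y

  walk⇒ends : ∀ {a} l {u v} → Walk a (suc (suc l)) u v → Ends a l u v
  walk⇒ends zero    (x , s , cx , s′) = ends s s′ cx s s′ refl
  walk⇒ends (suc l) (x , s , cx , w) with walk⇒ends l w
  ... | ends _ s′ _ init _ _ = ends s s′ cx (x , s , cx , init) w init

  -- Some shortest monochromatic walk from u to v, of length l + 2, has first edge e and last edge f.
  record Joins (u v : Fin n) (e f : Fin n × Fin n) : Set where
    constructor joins
    field
      {a}      : Fin c
      {l}      : ℕ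
      endSteps : Ends a l u v
      minimal  : ∀ {k} → Walk a k u v → suc (suc l) ≤ k
    open Ends endSteps public
    field
      e≡       : e ≡ edge u x
      f≡       : f ≡ edge y v

  ecol-edge : ∀ {i j} → adj G i j ≡ true → ecol col (proj₁ (edge i j)) (proj₂ (edge i j)) ≡ ecol col i j
  ecol-edge {i} {j} adj-ij with edge-cases i j
  ... | inj₁ eq rewrite eq = refl
  ... | inj₂ eq rewrite eq = sym (ecol-sym col i j adj-ij)

  -- The colour of the walk can be read off `e`, so two walks with the same first edge have the same
  -- colour, and each minimality bound applies to pieces of the other walk.
  joins-color : ∀ {u v e f} (J : Joins u v e f) → ecol col (proj₁ e) (proj₂ e) ≡ Joins.a J
  joins-color (joins E _ refl _) = trans (ecol-edge (proj₁ (Ends.first E))) (proj₂ (Ends.first E))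

  private
    absurd : ∀ {l k} → suc (suc l) ≤ suc k → suc (suc k) ≤ suc l → ⊥
    absurd p q = <-asym (s≤s⁻¹ p) (s≤s⁻¹ q)

  -- Any other choice of far ends of the two edges would yield a shorter walk between u and v.
  joins-injective : ∀ {u v u′ v′ e f} → Joins u v e f → Joins u′ v′ e f → (u , v) ≡ (u′ , v′)
  joins-injective J J′ with trans (sym (joins-color J)) (joins-color J′)
  joins-injective (joins (ends _ _ _ dl df inn) min refl refl)
                  (joins (ends _ _ _ dl′ df′ inn′) min′ e≡ f≡) | refl
    with edge-injective e≡ | edge-injective f≡
  ... | inj₁ (refl , refl) | inj₁ (refl , refl) = refl
  -- Here `y` is `v′` and `v` is `y′`: either walk without its last edge joins the ends of the
  -- other, so each length would be smaller than the other. The remaining cases cut the first edge,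
  -- or both end edges.
  ... | inj₁ (refl , refl) | inj₂ (refl , refl) = contradiction (min′ dl) (absurd (min dl′))
  ... | inj₂ (refl , refl) | inj₁ (refl , refl) = contradiction (min′ df) (absurd (min df′))
  ... | inj₂ (refl , refl) | inj₂ (refl , refl) =
    contradiction (m≤n⇒m≤1+n (min′ inn)) (absurd (m≤n⇒m≤1+n (min inn′)))

  -- Were the two edges equal, `u` and `v` would coincide or be joined by a single edge of the
  -- colour, against minimality. Hence the pairs `(e , e)` stay free for the shared edges in
  -- `2nonEdges+shared≤`.
  joins-≢ : ∀ {u v e f} → Joins u v e f → e ≢ f
  joins-≢ (joins (ends s _ _ _ _ _) min refl refl) eq with edge-injective eq
  ... | inj₁ (refl , refl) = contradiction (min {1} s) λ { (s≤s ()) }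
  ... | inj₂ (refl , refl) = contradiction (min {0} refl) λ ()

  -- Upper bound: counting colours and non-edges by shared edges.

  Shared : Fin n × Fin n → Set
  Shared (i , j) = ∃[ v ] vcol col v ≡ ecol col i j

  shared? : Decidable Shared
  shared? (i , j) = any? (λ v → vcol col v Fin.≟ ecol col i j)

  sharedEdges : List (Fin n × Fin n)
  sharedEdges = filter shared? (edges G)

  privateEdges : List (Fin n × Fin n)
  privateEdges = filter (¬? ∘ shared?) (edges G)

  step∈sharedEdges : ∀ {a i j v} → Step a i j → vcol col v ≡ a → edge i j ∈ sharedEdges
  step∈sharedEdges {v = v} (adj-ij , refl) cv =
    ∈-filter⁺ shared? (edge∈edges G adj-ij) (v , trans cv (sym (ecol-edge adj-ij)))

  colors≤ : c ≤ n + length privateEdges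
  colors≤ = lengths (injectiveRel⇒length≤ {R = Has} {ys = map inj₁ (allFin n) ++ map inj₂ privateEdges}
              (Unique.allFin⁺ c) (λ {a} _ → carrier a) unique)
    where
    Has : Fin c → Fin n ⊎ (Fin n × Fin n) → Set
    Has a (inj₁ v)       = vcol col v ≡ a
    Has a (inj₂ (i , j)) = ecol col i j ≡ a
    unique : ∀ {a a′ y} → Has a y → Has a′ y → a ≡ a′
    unique {y = inj₁ _} p q = trans (sym p) q
    unique {y = inj₂ _} p q = trans (sym p) q
    carrier : ∀ a → ∃[ y ] (y ∈ map inj₁ (allFin n) ++ map inj₂ privateEdges × Has a y)
    carrier a with any? (λ v → vcol col v Fin.≟ a) | allUsed col a
    ... | yes (v , p) | _            = inj₁ v , ∈-++⁺ˡ (∈-map⁺ inj₁ (∈-allFin v)) , p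
    ... | no  ¬v      | inj₁ v       = contradiction v ¬v
    -- No vertex has the colour `a`, so an edge carrying it is private.
    ... | no  ¬v      | inj₂ (i , j , adj-ij , p) = inj₂ (edge i j) ,
      ∈-++⁺ʳ (map inj₁ (allFin n)) (∈-map⁺ inj₂ (∈-filter⁺ (¬? ∘ shared?) (edge∈edges G adj-ij)
        (λ { (v , q) → ¬v (v , trans q q′) }))) , q′
      where q′ = trans (ecol-edge adj-ij) p
    lengths : length (allFin c) ≤ length (map inj₁ (allFin n) ++ map inj₂ privateEdges) → c ≤ n + length privateEdges
    lengths le rewrite length-tabulate {n = c} id
                     | length-++ (map {B = Fin n ⊎ (Fin n × Fin n)} inj₁ (allFin n)) {map inj₂ privateEdges}
                     | length-map {B = Fin n ⊎ (Fin n × Fin n)} inj₁ (allFin n)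
                     | length-map {B = Fin n ⊎ (Fin n × Fin n)} inj₂ privateEdges
                     | length-tabulate {n = n} id = le

  colors+shared≤ : c + length sharedEdges ≤ n + edgeCount G
  colors+shared≤ = begin
    c + length sharedEdges                           ≤⟨ +-monoˡ-≤ _ colors≤ ⟩
    n + length privateEdges + length sharedEdges     ≡⟨ +-assoc n _ _ ⟩
    n + (length privateEdges + length sharedEdges)   ≡⟨ cong (n +_) (+-comm (length privateEdges) _) ⟩
    n + (length sharedEdges + length privateEdges)   ≡⟨ cong (n +_) (length-filter-complement shared? (edges G)) ⟩
    n + length (edges G)                             ≡⟨ cong (n +_) (edgeCount≡length G) ⟨
    n + edgeCount G                                  ∎
    where open ≤-Reasoning

  joined : IsTMC col → ∀ {u v} → u ≢ v → adj G u v ≢ true →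
    ∃[ p ] (p ∈ cartesianProduct sharedEdges sharedEdges × Joins u v (proj₁ p) (proj₂ p))
  joined tmc {u} {v} u≢v ¬adj with a , l , w ← IsTMC⇒walk tmc u v with minimum (λ k → walk? a k u v) {l} w
  ... | zero        , u≡v , _ = contradiction u≡v u≢v
  ... | suc zero    , s   , _ = contradiction (proj₁ s) ¬adj
  ... | suc (suc l) , w′  , min with E ← walk⇒ends l w′ =
    (edge u (Ends.x E) , edge (Ends.y E) v) ,
    ∈-cartesianProduct⁺ (step∈sharedEdges (Ends.first E) (Ends.x-colored E))
                        (step∈sharedEdges (Ends.last E) (Ends.x-colored E)) ,
    joins E min refl refl

  -- For N non-edges and w shared edges this is N ≤ `w C 2`, freed of division and subtraction.
  2nonEdges+shared≤ : IsTMC col →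
    length (nonEdges G) + length (nonEdges G) + length sharedEdges ≤ length sharedEdges * length sharedEdges
  2nonEdges+shared≤ tmc = lengths (injectiveRel⇒length≤ {R = R} {ys = cartesianProduct sharedEdges sharedEdges}
      unique total (λ {x} {x′} → injective {x} {x′}))
    where
    N = nonEdges G
    Source = (Fin n × Fin n) ⊎ (Fin n × Fin n)
    -- Ordered pairs avoid halving: a non-edge is counted in both orientations, and a shared edge e stands for (e , e).
    sources : List Source
    sources = map inj₁ (N ++ map swap N) ++ map inj₂ sharedEdges
    R : Source → (Fin n × Fin n) × (Fin n × Fin n) → Set
    R (inj₁ (u , v)) (e , f) = Joins u v e f
    R (inj₂ d)       (e , f) = d ≡ e × d ≡ f
    injective : ∀ {x x′ y} → R x y → R x′ y → x ≡ x′
    injective {inj₁ _} {inj₁ _} J J′ = cong inj₁ (joins-injective J J′)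
    injective {inj₁ _} {inj₂ _} J (refl , refl) = contradiction refl (joins-≢ J)
    injective {inj₂ _} {inj₁ _} (refl , refl) J = contradiction refl (joins-≢ J)
    injective {inj₂ _} {inj₂ _} (refl , refl) (refl , refl) = refl
    N-unique : Unique N
    N-unique = Unique.filter⁺ (¬? ∘ adjacent? G) (allPairs-unique n)
    N< : ∀ {u v} → (u , v) ∈ N → u Fin.< v
    N< p = ∈-allPairs⁻ (proj₁ (∈-filter⁻ (¬? ∘ adjacent? G) {xs = allPairs n} p))
    ¬adjacent : ∀ {p} → p ∈ N → ¬ Adjacent G p
    ¬adjacent p = proj₂ (∈-filter⁻ (¬? ∘ adjacent? G) {xs = allPairs n} p)
    N-disjoint : ∀ {p} → ¬ (p ∈ N × p ∈ map swap N)
    N-disjoint (p∈ , q∈) with _ , q , refl ← ∈-map⁻ swap q∈ = Fin.<-asym (N< p∈) (N< q)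
    unique : Unique sources
    unique = Unique.++⁺
      (Unique.map⁺ inj₁-injective (Unique.++⁺ N-unique (Unique.map⁺ (cong swap) N-unique) N-disjoint))
      (Unique.map⁺ inj₂-injective (Unique.filter⁺ shared? (edges-unique G)))
      (λ (p , q) → sides p q)
      where
      sides : ∀ {p} → p ∈ map inj₁ (N ++ map swap N) → p ∈ map inj₂ sharedEdges → ⊥
      sides p q with _ , _ , refl ← ∈-map⁻ inj₁ p with _ , _ , () ← ∈-map⁻ inj₂ q
    total : ∀ {x} → x ∈ sources → ∃[ y ] (y ∈ cartesianProduct sharedEdges sharedEdges × R x y)
    total x∈ with ∈-++⁻ (map inj₁ (N ++ map swap N)) x∈
    ... | inj₂ p with d , d∈ , refl ← ∈-map⁻ inj₂ p = (d , d) , ∈-cartesianProduct⁺ d∈ d∈ , refl , refl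
    ... | inj₁ p with _ , q , refl ← ∈-map⁻ inj₁ p with ∈-++⁻ N q
    ...   | inj₁ r = joined tmc (Fin.<⇒≢ (N< r)) (¬adjacent r)
    ...   | inj₂ r with (u , v) , s , refl ← ∈-map⁻ swap r =
      joined tmc (Fin.<⇒≢ (N< s) ∘ sym) (λ adj-vu → ¬adjacent s (trans (Graph.sym G u v) adj-vu))
    lengths : length sources ≤ length (cartesianProduct sharedEdges sharedEdges) →
      length N + length N + length sharedEdges ≤ length sharedEdges * length sharedEdges
    lengths le rewrite length-++ (map {B = Source} inj₁ (N ++ map swap N)) {map inj₂ sharedEdges}
                     | length-map {B = Source} inj₁ (N ++ map swap N)
                     | length-map {B = Source} inj₂ sharedEdges
                     | length-++ N {map swap N}
                     | length-map {B = Fin n × Fin n} swap N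
                     | length-cartesianProduct sharedEdges sharedEdges = le

-- Short paths, and complete graphs with deleted edges.

∈-take⁻ : {A : Set} (k : ℕ) {xs : List A} {x : A} → x ∈ take k xs → x ∈ xs
∈-take⁻ k {xs} x∈ = subst (_ ∈_) (take++drop≡id k xs) (∈-++⁺ˡ x∈)

module _ {n : ℕ} where

  open DecMembership (≡-dec (Fin._≟_ {n}) (Fin._≟_ {n})) public using (_∈?_)

  module _ {G : Graph n} where

    trivialPath : ∀ u → Path G u u
    trivialPath u = record
      { len = 0 ; verts = λ _ → u ; start = refl ; end = refl
      ; distinct = λ { {Fin.zero} {Fin.zero} _ → refl } ; adjacent = λ () }

    edgePath : ∀ {u v} → adj G u v ≡ true → Path G u v
    edgePath {u} {v} a = record
      { len = 1 ; verts = λ { Fin.zero → u ; (Fin.suc _) → v } ; start = refl ; end = refl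
      ; distinct = λ { {Fin.zero} {Fin.zero} _ → refl
                     ; {Fin.zero} {Fin.suc Fin.zero} eq → contradiction eq (adjacent⇒≢ G a)
                     ; {Fin.suc Fin.zero} {Fin.zero} eq → contradiction (sym eq) (adjacent⇒≢ G a)
                     ; {Fin.suc Fin.zero} {Fin.suc Fin.zero} _ → refl }
      ; adjacent = λ { Fin.zero → a } }

    twoEdgePath : ∀ {u x v} → adj G u x ≡ true → adj G x v ≡ true → u ≢ v → Path G u v
    twoEdgePath {u} {x} {v} a b u≢v = record
      { len = 2 ; verts = f ; start = refl ; end = refl ; distinct = inj
      ; adjacent = λ { Fin.zero → a ; (Fin.suc Fin.zero) → b } }
      where
      f : Fin 3 → Fin n
      f Fin.zero              = u
      f (Fin.suc Fin.zero)    = x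
      f (Fin.suc (Fin.suc _)) = v
      inj : Injective _≡_ _≡_ f
      inj {Fin.zero} {Fin.zero} _ = refl
      inj {Fin.zero} {Fin.suc Fin.zero} eq = contradiction eq (adjacent⇒≢ G a)
      inj {Fin.zero} {Fin.suc (Fin.suc Fin.zero)} eq = contradiction eq u≢v
      inj {Fin.suc Fin.zero} {Fin.zero} eq = contradiction (sym eq) (adjacent⇒≢ G a)
      inj {Fin.suc Fin.zero} {Fin.suc Fin.zero} _ = refl
      inj {Fin.suc Fin.zero} {Fin.suc (Fin.suc Fin.zero)} eq = contradiction eq (adjacent⇒≢ G b)
      inj {Fin.suc (Fin.suc Fin.zero)} {Fin.zero} eq = contradiction (sym eq) u≢v
      inj {Fin.suc (Fin.suc Fin.zero)} {Fin.suc Fin.zero} eq = contradiction (sym eq) (adjacent⇒≢ G b)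
      inj {Fin.suc (Fin.suc Fin.zero)} {Fin.suc (Fin.suc Fin.zero)} _ = refl

  allPairsExcept : List (Fin n × Fin n) → List (Fin n × Fin n)
  allPairsExcept D = filter (λ p → ¬? (p ∈? D)) (allPairs n)

  ∈-allPairsExcept⁺ : ∀ D {p} → p ∈ allPairs n → p ∉ D → p ∈ allPairsExcept D
  ∈-allPairsExcept⁺ D = ∈-filter⁺ (λ p → ¬? (p ∈? D))

  ∈-allPairsExcept⁻ : ∀ D {p} → p ∈ allPairsExcept D → p ∈ allPairs n × p ∉ D
  ∈-allPairsExcept⁻ D = ∈-filter⁻ (λ p → ¬? (p ∈? D)) {xs = allPairs n}

  -- Membership is tested on `edge i j`, which makes adjacency symmetric; loops are excluded because
  -- `allPairs n` holds only increasing pairs. Pairs to be deleted are accordingly listed with the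
  -- smaller end first.
  completeMinus : List (Fin n × Fin n) → Graph n
  completeMinus D = record
    { adj    = λ i j → does (edge i j ∈? allPairsExcept D)
    ; sym    = λ i j → cong (λ p → does (p ∈? allPairsExcept D)) (edge-comm i j)
    ; irrefl = λ i → dec-false (edge i i ∈? allPairsExcept D) (loop i)
    }
    where
    loop : ∀ i → edge i i ∉ allPairsExcept D
    loop i p with edge-cases i i
    ... | inj₁ eq = Fin.<-irrefl refl (∈-allPairs⁻ (proj₁ (∈-allPairsExcept⁻ D (subst (_∈ _) eq p))))
    ... | inj₂ eq = Fin.<-irrefl refl (∈-allPairs⁻ (proj₁ (∈-allPairsExcept⁻ D (subst (_∈ _) eq p))))

  module _ {D : List (Fin n × Fin n)} where

    completeMinus-adjacent⁺ : ∀ {i j} → edge i j ∈ allPairsExcept D → adj (completeMinus D) i j ≡ true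
    completeMinus-adjacent⁺ {i} {j} = dec-true (edge i j ∈? allPairsExcept D)

    completeMinus-adjacent⁻ : ∀ {i j} → adj (completeMinus D) i j ≡ true → edge i j ∈ allPairsExcept D
    completeMinus-adjacent⁻ {i} {j} eq with edge i j ∈? allPairsExcept D
    ... | yes p = p

    edgeCount-completeMinus : Unique D → (∀ {p} → p ∈ D → p ∈ allPairs n) →
      edgeCount (completeMinus D) + length D ≤ n C 2
    edgeCount-completeMinus D-unique D⊆ = begin
      edgeCount G + length D        ≡⟨ cong (_+ length D) (edgeCount≡length G) ⟩
      length (edges G) + length D   ≡⟨ length-++ (edges G) ⟨
      length (edges G ++ D)         ≤⟨ ⊆⇒length≤ (Unique.++⁺ (edges-unique G) D-unique disjoint) ⊆P ⟩
      length (allPairs n)           ≡⟨ length-allPairs n ⟩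
      n C 2                         ∎
      where
      open ≤-Reasoning
      G = completeMinus D
      disjoint : ∀ {p} → ¬ (p ∈ edges G × p ∈ D)
      disjoint {i , j} (p , q) with p∈P , a ← ∈-filter⁻ (adjacent? G) {xs = allPairs n} p =
        proj₂ (∈-allPairsExcept⁻ D (subst (_∈ _) (edge-< (∈-allPairs⁻ p∈P)) (completeMinus-adjacent⁻ a))) q
      ⊆P : ∀ {p} → p ∈ edges G ++ D → p ∈ allPairs n
      ⊆P p with ∈-++⁻ (edges G) p
      ... | inj₁ q = proj₁ (∈-filter⁻ (adjacent? G) q)
      ... | inj₂ q = D⊆ q

-- Lower bound: a graph and a TMC-coloring with many colours.

module _ {m t d : ℕ} (t≤m : t ≤ m) (d≤ : d ≤ t C 2) where

  private
    n : ℕ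
    n = suc m

    hub : Fin n
    hub = Fin.zero

    -- Taken among the successors, so the hub 0 stays outside; `t≤m` provides enough of them. The
    -- increasing order puts the pairs of `T` into the normal form of `edge`.
    T : List (Fin n)
    T = take t (map Fin.suc (allFin m))

    T-sorted : AllPairs Fin._<_ T
    T-sorted = AllPairs.take⁺ t (AllPairs.map⁺ (AllPairs.map s≤s (allFin-sorted m)))

    T-unique : Unique T
    T-unique = AllPairs.map Fin.<⇒≢ T-sorted

    length-T : length T ≡ t
    length-T = trans (length-take t _)
      (m≤n⇒m⊓n≡m (subst (t ≤_) (sym (trans (length-map Fin.suc (allFin m)) (length-tabulate {n = m} id))) t≤m))

    hub<T : ∀ {x} → x ∈ T → hub Fin.< x
    hub<T x∈ with _ , _ , refl ← ∈-map⁻ Fin.suc (∈-take⁻ t x∈) = s≤s z≤n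

    S D : List (Fin n × Fin n)
    S = map (hub ,_) T
    D = take d (pairs T)

    length-S : length S ≡ t
    length-S = trans (length-map {B = Fin n × Fin n} (hub ,_) T) length-T

    length-D : length D ≡ d
    length-D = trans (length-take d (pairs T))
      (m≤n⇒m⊓n≡m (subst (d ≤_) (sym (trans (length-pairs T) (cong (_C 2) length-T))) d≤))

    ∈-D⁻ : ∀ {i j} → (i , j) ∈ D → i ∈ T × j ∈ T × i Fin.< j
    ∈-D⁻ p = ∈-pairs⁻ T-sorted (∈-take⁻ d p)

    G : Graph n
    G = completeMinus D

    B : List (Fin n × Fin n)
    B = allPairsExcept (S ++ D)

    B-unique : Unique B
    B-unique = Unique.filter⁺ (λ p → ¬? (p ∈? (S ++ D))) (allPairs-unique n)

    -- One colour per vertex, followed by one per position in `B`.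
    c : ℕ
    c = n + length B

    vertexColor : Fin n → Fin c
    vertexColor v = v ↑ˡ length B

    -- The second clause is meant for `S`, whose pairs share the colour of the hub; for deleted
    -- pairs and loops it is a default value.
    pairColor : Fin n × Fin n → Fin c
    pairColor p with p ∈? B
    ... | yes p∈ = n ↑ʳ index p∈
    ... | no  _  = vertexColor hub

    pairColor-B : ∀ k → pairColor (lookup B k) ≡ n ↑ʳ k
    pairColor-B k with lookup B k ∈? B
    ... | yes p∈ = cong (n ↑ʳ_) (lookup-injective B-unique (sym (lookup-index p∈)))
    ... | no  p∉ = contradiction (∈-lookup k) p∉

    pairColor-S : ∀ {p} → p ∈ S → pairColor p ≡ vertexColor hub
    pairColor-S {p} p∈S with p ∈? B
    ... | yes p∈ = contradiction (∈-++⁺ˡ p∈S) (proj₂ (∈-allPairsExcept⁻ (S ++ D) p∈))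
    ... | no  _  = refl

    color-used : ∀ a → (∃[ v ] vertexColor v ≡ a) ⊎
      (∃[ i ] ∃[ j ] (adj G i j ≡ true × pairColor (edge i j) ≡ a))
    color-used a with splitAt n a in eq
    ... | inj₁ v = inj₁ (v , splitAt⁻¹-↑ˡ eq)
    ... | inj₂ k with p∈P , p∉ ← ∈-allPairsExcept⁻ (S ++ D) (∈-lookup {xs = B} k) =
      let edge≡ = edge-< (∈-allPairs⁻ p∈P) in
      inj₂ (_ , _ ,
        completeMinus-adjacent⁺ (subst (_∈ _) (sym edge≡) (∈-allPairsExcept⁺ D p∈P (p∉ ∘ ∈-++⁺ʳ S))) ,
        trans (cong pairColor edge≡) (trans (pairColor-B k) (splitAt⁻¹-↑ʳ eq)))

    coloring : TotalColoring G c
    coloring = record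
      { vcol     = vertexColor
      ; ecol     = λ i j → pairColor (edge i j)
      ; ecol-sym = λ i j _ → cong pairColor (edge-comm i j)
      ; allUsed  = color-used
      }

    -- Deleted pairs have both ends in `T`, which avoids the hub.
    hub-adjacent : ∀ {x} → x ∈ T → adj G hub x ≡ true
    hub-adjacent x∈ = completeMinus-adjacent⁺ (subst (_∈ _) (sym (edge-< (hub<T x∈)))
      (∈-allPairsExcept⁺ D (∈-allPairs⁺ (hub<T x∈)) (λ p → contradiction (hub<T (proj₁ (∈-D⁻ p))) λ ())))

    hub-color : ∀ {x} → x ∈ T → pairColor (edge hub x) ≡ vertexColor hub
    hub-color x∈ = trans (cong pairColor (edge-< (hub<T x∈))) (pairColor-S (∈-map⁺ (hub ,_) x∈))

    nonadjacent⇒∈T : ∀ {u v} → u ≢ v → adj G u v ≢ true → u ∈ T × v ∈ T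
    nonadjacent⇒∈T {u} {v} u≢v ¬adj with edge u v ∈? D
    ... | no p∉ = contradiction (completeMinus-adjacent⁺ (∈-allPairsExcept⁺ D (edge∈allPairs u≢v) p∉)) ¬adj
    ... | yes p∈ with edge-cases u v
    ...   | inj₁ eq = let p , q , _ = ∈-D⁻ (subst (_∈ D) eq p∈) in p , q
    ...   | inj₂ eq = let p , q , _ = ∈-D⁻ (subst (_∈ D) eq p∈) in q , p

    -- Only pairs inside `T` were deleted, so distinct non-adjacent vertices are joined through the
    -- hub, where both edges and the one internal vertex have the colour of the hub. Shorter paths
    -- have no internal vertex.
    isTMC : IsTMC coloring
    isTMC u v with u Fin.≟ v
    ... | yes refl = trivialPath u , vertexColor u , (λ ()) , λ _ _ ()
    ... | no u≢v with adj G u v Bool.≟ true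
    ...   | yes a = edgePath a , pairColor (edge u v) , (λ { Fin.zero → refl }) ,
                    (λ { (Fin.suc Fin.zero) _ (s≤s ()) })
    ...   | no ¬a with u∈ , v∈ ← nonadjacent⇒∈T u≢v ¬a =
      twoEdgePath (trans (Graph.sym G u hub) (hub-adjacent u∈)) (hub-adjacent v∈) u≢v , vertexColor hub ,
      (λ { Fin.zero → trans (cong pairColor (edge-comm u hub)) (hub-color u∈) ; (Fin.suc Fin.zero) → hub-color v∈ }) ,
      (λ { (Fin.suc Fin.zero) _ _ → refl ; (Fin.suc (Fin.suc Fin.zero)) _ (s≤s (s≤s ())) })

    pairs≤ : n C 2 ≤ length B + (t + d)
    pairs≤ = begin
      n C 2                             ≡⟨ length-allPairs n ⟨
      length (allPairs n)               ≤⟨ ⊆⇒length≤ (allPairs-unique n) covered ⟩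
      length (B ++ (S ++ D))            ≡⟨ length-++ B ⟩
      length B + length (S ++ D)        ≡⟨ cong (length B +_) (length-++ S) ⟩
      length B + (length S + length D)  ≡⟨ cong (length B +_) (cong₂ _+_ length-S length-D) ⟩
      length B + (t + d)                ∎
      where
      open ≤-Reasoning
      covered : ∀ {p} → p ∈ allPairs n → p ∈ B ++ (S ++ D)
      covered {p} p∈ with p ∈? (S ++ D)
      ... | yes q = ∈-++⁺ʳ B q
      ... | no  q = ∈-++⁺ˡ (∈-allPairsExcept⁺ (S ++ D) p∈ q)

  -- Compared with one colour for each vertex and each pair, deleting `d` pairs costs `d` colours,
  -- and giving `t` edges the colour of the hub costs `t` more.
  manyColors : ∃[ G ] (Connected {n} G × edgeCount G + d ≤ n C 2 ×
    ∃[ c ] Σ (TotalColoring G c) (λ col → IsTMC col × n + n C 2 ≤ c + (t + d)))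
  manyColors = G , (λ u v → proj₁ (isTMC u v)) ,
    subst (λ k → edgeCount G + k ≤ n C 2) length-D
      (edgeCount-completeMinus (Unique.take⁺ d (pairs-unique T-unique))
        (λ p → ∈-allPairs⁺ (proj₂ (proj₂ (∈-D⁻ p))))) ,
    c , coloring , isTMC ,
    subst (n + n C 2 ≤_) (sym (+-assoc n (length B) (t + d))) (+-monoʳ-≤ n pairs≤)

-- Arithmetic of binomial coefficients.

suc-C-2 : ∀ m → suc m C 2 ≡ m + m C 2
suc-C-2 m = trans (sym (nCk+nC[k+1]≡[n+1]C[k+1] m 1)) (cong (_+ m C 2) (nC1≡n m))

-- Pairs in a disjoint union lie in the first set, across, or in the second; the proof is by
-- induction on `b`.
+-C-2 : ∀ a b → (b + a) C 2 ≡ a C 2 + b * a + b C 2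
+-C-2 a zero    = sym (trans (+-identityʳ _) (+-identityʳ _))
+-C-2 a (suc b) = begin
  suc (b + a) C 2                           ≡⟨ suc-C-2 (b + a) ⟩
  (b + a) + (b + a) C 2                     ≡⟨ cong ((b + a) +_) (+-C-2 a b) ⟩
  (b + a) + (a C 2 + b * a + b C 2)         ≡⟨ rearrange a b (b * a) (a C 2) (b C 2) ⟩
  a C 2 + (a + b * a) + (b + b C 2)         ≡⟨ cong (a C 2 + (a + b * a) +_) (suc-C-2 b) ⟨
  a C 2 + suc b * a + suc b C 2             ∎
  where
  open ≡-Reasoning
  rearrange : ∀ a b p x y → (b + a) + (x + p + y) ≡ x + (a + p) + (b + y)
  rearrange = solve-∀

2*C-2 : ∀ w → w C 2 + w C 2 + w ≡ w * w
2*C-2 zero    = refl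
2*C-2 (suc w) rewrite suc-C-2 w = trans (collect w (w C 2)) (trans (cong (λ z → z + w + suc w) (2*C-2 w)) (square w))
  where
  collect : ∀ w x → (w + x) + (w + x) + suc w ≡ (x + x + w) + w + suc w
  collect = solve-∀
  square : ∀ w → w * w + w + suc w ≡ suc w * suc w
  square = solve-∀

C-2-mono : ∀ {w t} → w ≤ t → w C 2 ≤ t C 2
C-2-mono {w} {t} w≤t = subst (λ z → w C 2 ≤ z C 2) (m∸n+n≡m w≤t)
  (≤-trans (≤-trans (m≤m+n (w C 2) _) (m≤m+n _ ((t ∸ w) C 2))) (≤-reflexive (sym (+-C-2 w (t ∸ w)))))

halve-≤ : ∀ {x y} → x + x ≤ y + y → x ≤ y
halve-≤ {x} {y} le with x ≤? y
... | yes x≤y = x≤y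
... | no  x≰y = contradiction le (<⇒≱ (+-mono-< (≰⇒> x≰y) (≰⇒> x≰y)))

-- A criterion for the value of g from both bounds.

IsTMC⇒colors≤ : ∀ {n c} {G : Graph n} (col : TotalColoring G c) → IsTMC col →
  ∀ s → edgeCount G + s C 2 < n C 2 → c + suc s ≤ n + edgeCount G
IsTMC⇒colors≤ {n} {c} {G} col tmc s few with suc s ≤? length (sharedEdges col)
... | yes s<w = ≤-trans (+-monoʳ-≤ c s<w) (colors+shared≤ col)
-- At most `s` shared edges would allow at most `s C 2` non-adjacent pairs, against `few`.
... | no  s≮w = contradiction few (≤⇒≯ (begin
  n C 2                            ≡⟨ edgeCount+nonEdges G ⟨
  edgeCount G + length (nonEdges G) ≤⟨ +-monoʳ-≤ (edgeCount G) (≤-trans N≤ (C-2-mono (≮⇒≥ s≮w))) ⟩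
  edgeCount G + s C 2              ∎))
  where
  open ≤-Reasoning
  w : ℕ
  w = length (sharedEdges col)
  N≤ : length (nonEdges G) ≤ w C 2
  N≤ = halve-≤ (+-cancelʳ-≤ w _ _
    (≤-trans (2nonEdges+shared≤ col tmc) (≤-reflexive (sym (2*C-2 w)))))

-- The inequalities with `s` force `suc s` shared edges in every graph with at most `g` edges and so
-- at most `k` colours; those with `t` yield a graph with at most `suc g` edges and more than `k`
-- colours. The two parameters are separate because `t` is `suc s` in the generic case but `s` in
-- the boundary case.
isG-criterion : ∀ {n k g} s t → g + s C 2 < n C 2 → n + g ≤ k + suc s →
  t < n → n C 2 ≤ suc g + t C 2 → k + t ≤ n + g → IsG n k g
isG-criterion {suc m} {k} {g} s t few bound t<n enough many =
  <⇒≤ g<M , good , optimal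
  where
  n M d : ℕ
  n = suc m
  M = n C 2
  -- Deleting this many pairs leaves at most `suc g` edges, which any `m′` above `g` allows; by
  -- `enough` they fit inside `t` vertices.
  d = M ∸ suc g
  g<M : g < M
  g<M = ≤-<-trans (m≤m+n g (s C 2)) few
  suc-g+d : suc g + d ≡ M
  suc-g+d = m+[n∸m]≡n g<M
  good : Good n k g
  good G _ e≤g c col tmc = +-cancelʳ-≤ (suc s) c k (≤-trans
    (IsTMC⇒colors≤ col tmc s (≤-<-trans (+-monoˡ-≤ (s C 2) e≤g) few))
    (≤-trans (+-monoʳ-≤ n e≤g) bound))
  d≤ : d ≤ t C 2
  d≤ = +-cancelˡ-≤ (suc g) d (t C 2) (≤-trans (≤-reflexive suc-g+d) enough)
  optimal : ∀ m′ → m′ ≤ M → Good n k m′ → m′ ≤ g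
  optimal m′ _ good′ with m′ ≤? g
  ... | yes m′≤g = m′≤g
  ... | no  m′≰g with G , conn , e+d≤ , c , col , tmc , c≥ ← manyColors (s≤s⁻¹ t<n) d≤ =
    contradiction (good′ G conn e≤m′ c col tmc) (<⇒≱ k<c)
    where
    e≤m′ : edgeCount G ≤ m′
    e≤m′ = ≤-trans (+-cancelʳ-≤ d _ _ (≤-trans e+d≤ (≤-reflexive (sym suc-g+d)))) (≰⇒> m′≰g)
    k<c : k < c
    k<c = +-cancelʳ-≤ (t + d) (suc k) c (begin
      suc k + (t + d)     ≡⟨ +-assoc (suc k) t d ⟨
      suc (k + t) + d     ≤⟨ +-monoˡ-≤ d (s≤s many) ⟩
      suc (n + g) + d     ≡⟨ cong (_+ d) (+-suc n g) ⟨
      n + suc g + d       ≡⟨ +-assoc n (suc g) d ⟩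
      n + (suc g + d)     ≡⟨ cong (n +_) suc-g+d ⟩
      n + M               ≤⟨ c≥ ⟩
      c + (t + d)         ∎)
      where open ≤-Reasoning

-- The four cases of the formula.

+-suc-C-2 : ∀ a s → (suc s + a) C 2 ≡ a C 2 + suc s * a + s + s C 2
+-suc-C-2 a s = trans (+-C-2 a (suc s))
  (trans (cong (a C 2 + suc s * a +_) (suc-C-2 s)) (sym (+-assoc _ s (s C 2))))

-- Here `s` and `a` are `t ∸ 1` and `n ∸ t ∸ 1`, so the bounds on `k` are free of truncated
-- subtraction. `h` counts the pairs not inside a fixed set of `t` vertices: `lower` gives `h ≤ g`,
-- so the deleted pairs fit into that set, and `upper` leaves every graph with at most `g` edges
-- more than `s C 2` non-adjacent pairs.
isG-generic : ∀ {n k} s a → n ≡ suc s + suc a → n ≤ k →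
  suc a C 2 + suc s * a + n ≤ k → k + 2 ≤ suc a C 2 + suc s * suc a + n → IsG n k (k ∸ n + suc s)
isG-generic {n} {k} s a refl n≤k lower upper =
  isG-criterion s (suc s) few (≤-reflexive n+g) (s≤s (m<m+n s (s≤s z≤n))) enough (≤-reflexive (sym n+g))
  where
  open ≤-Reasoning
  h g : ℕ
  h = suc a C 2 + suc s * suc a
  g = k ∸ n + suc s
  n+g : n + g ≡ k + suc s
  n+g = trans (sym (+-assoc n (k ∸ n) (suc s))) (cong (_+ suc s) (m+[n∸m]≡n n≤k))
  few : g + s C 2 < n C 2
  few = +-cancelˡ-≤ n _ _ (begin
    n + suc (g + s C 2)       ≡⟨ shift n g (s C 2) ⟩
    suc (n + g) + s C 2       ≡⟨ cong (λ z → suc z + s C 2) n+g ⟩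
    suc (k + suc s) + s C 2   ≡⟨ shift′ k s (s C 2) ⟩
    k + 2 + s + s C 2         ≤⟨ +-monoˡ-≤ (s C 2) (+-monoˡ-≤ s upper) ⟩
    h + n + s + s C 2         ≡⟨ shift″ h n s (s C 2) ⟩
    n + (h + s + s C 2)       ≡⟨ cong (n +_) (+-suc-C-2 (suc a) s) ⟨
    n + n C 2                 ∎)
    where
    shift : ∀ n g x → n + suc (g + x) ≡ suc (n + g) + x
    shift = solve-∀
    shift′ : ∀ k s x → suc (k + suc s) + x ≡ k + 2 + s + x
    shift′ = solve-∀
    shift″ : ∀ h n s x → h + n + s + x ≡ n + (h + s + x)
    shift″ = solve-∀
  enough : n C 2 ≤ suc g + suc s C 2
  enough = begin
    n C 2              ≡⟨ +-C-2 (suc a) (suc s) ⟩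
    h + suc s C 2      ≤⟨ +-monoˡ-≤ (suc s C 2) (m≤n⇒m≤1+n h≤g) ⟩
    suc g + suc s C 2  ∎
    where
    shift : ∀ n x s a → n + (x + suc s * suc a) ≡ x + suc s * a + n + suc s
    shift = solve-∀
    h≤g : h ≤ g
    h≤g = +-cancelˡ-≤ n h g (begin
      n + h                                         ≡⟨ shift n (suc a C 2) s a ⟩
      suc a C 2 + suc s * a + n + suc s             ≤⟨ +-monoˡ-≤ (suc s) lower ⟩
      k + suc s                                     ≡⟨ n+g ⟨
      n + g                                         ∎)

-- At this `k` a graph with `g` edges misses exactly `s C 2 + 1` pairs, which still forces `suc s`
-- shared edges. With one edge more, the `s C 2` missing pairs fit inside `s` vertices and a colour
-- is gained.
isG-boundary : ∀ {n k} s a → n ≡ suc s + suc a → n ≤ k →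
  k + 1 ≡ suc a C 2 + suc s * suc a + n → IsG n k (k ∸ n + s)
isG-boundary {n} {k} s a refl n≤k k+1≡ =
  isG-criterion s s (≤-reflexive (sym M≡)) (≤-trans (≤-reflexive n+g) (+-monoʳ-≤ k (n≤1+n s)))
    (s≤s (m≤m+n s (suc a))) (≤-reflexive M≡) (≤-reflexive (sym n+g))
  where
  open ≡-Reasoning
  h g : ℕ
  h = suc a C 2 + suc s * suc a
  g = k ∸ n + s
  n+g : n + g ≡ k + s
  n+g = trans (sym (+-assoc n (k ∸ n) s)) (cong (_+ s) (m+[n∸m]≡n n≤k))
  M≡ : n C 2 ≡ suc (g + s C 2)
  M≡ = +-cancelˡ-≡ n _ _ (begin
    n + n C 2              ≡⟨ cong (n +_) (+-suc-C-2 (suc a) s) ⟩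
    n + (h + s + s C 2)    ≡⟨ shift n h s (s C 2) ⟩
    h + n + s + s C 2      ≡⟨ cong (λ z → z + s + s C 2) k+1≡ ⟨
    k + 1 + s + s C 2      ≡⟨ shift′ k s (s C 2) ⟩
    suc (k + s) + s C 2    ≡⟨ cong (λ z → suc z + s C 2) n+g ⟨
    suc (n + g) + s C 2    ≡⟨ shift″ n g (s C 2) ⟩
    n + suc (g + s C 2)    ∎)
    where
    shift : ∀ n h s x → n + (h + s + x) ≡ h + n + s + x
    shift = solve-∀
    shift′ : ∀ k s x → k + 1 + s + x ≡ suc (k + s) + x
    shift′ = solve-∀
    shift″ : ∀ n g x → suc (n + g) + x ≡ n + suc (g + x)
    shift″ = solve-∀

-- The choice `s` = 1 works since `1 C 2` is 0. The choice `t` = 0 gives the complete graph with all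
-- colours distinct as the example exceeding `k`.
isG-almostComplete : ∀ {n k} → n ≤ k → k + 1 ≡ n C 2 + n → IsG n k (n C 2 ∸ 1)
isG-almostComplete {zero} {k} _ k+1≡ = contradiction (trans (+-comm 1 k) k+1≡) λ ()
isG-almostComplete {n@(suc m)} {k} n≤k k+1≡ = isG-criterion 1 0
  (≤-reflexive (trans (cong suc (+-identityʳ _)) suc-g)) (≤-trans (≤-reflexive n+g) (m≤m+n k 2))
  (s≤s z≤n) (≤-reflexive (trans (sym suc-g) (sym (+-identityʳ _)))) (≤-reflexive (trans (+-identityʳ k) (sym n+g)))
  where
  g : ℕ
  g = n C 2 ∸ 1
  0<M : 0 < n C 2
  0<M = +-cancelʳ-≤ n 1 (n C 2) (≤-trans (s≤s n≤k) (≤-reflexive (trans (sym (+-comm k 1)) k+1≡)))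
  suc-g : suc g ≡ n C 2
  suc-g = m+[n∸m]≡n 0<M
  n+g : n + g ≡ k
  n+g = suc-injective (trans (cong suc (+-comm n g)) (trans (cong (_+ n) suc-g) (trans (sym k+1≡) (+-comm k 1))))

-- Vertices and edges together bound the number of colours, and no graph has more than `n C 2`
-- edges.
isG-complete : ∀ n → IsG n (n C 2 + n) (n C 2)
isG-complete n = ≤-refl ,
  (λ G _ e≤ c col _ → ≤-trans (m≤m+n c _) (≤-trans (colors+shared≤ col)
    (≤-trans (+-monoʳ-≤ n e≤) (≤-reflexive (+-comm n _))))) ,
  (λ _ m′≤ _ → m′≤)

-- Removal of the truncated subtractions from the bounds.

theorem4 : ∀ (n k : ℕ) → 1 ≤ n → 1 ≤ k → n ≤ k → k ≤ n C 2 + n →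
    (∀ (t : ℕ) → 2 ≤ t → t ≤ n ∸ 1 →
    (n ∸ t) C 2 + t * (n ∸ t ∸ 1) + n ≤ k →
    k ≤ (n ∸ t) C 2 + t * (n ∸ t) + n ∸ 2 →
    IsG n k (k ∸ n + t))
    × (∀ (t : ℕ) → 2 ≤ t → t ≤ n ∸ 1 →
    k ≡ (n ∸ t) C 2 + t * (n ∸ t) + n ∸ 1 →
    IsG n k (k ∸ n + t ∸ 1))
    × (k ≡ n C 2 + n ∸ 1 → IsG n k (n C 2 ∸ 1))
    × (k ≡ n C 2 + n → IsG n k (n C 2))
theorem4 n k 1≤n 1≤k n≤k _ = generic , boundary , almostComplete , λ { refl → isG-complete n }
  where
  split : ∀ {s a} → suc s ≤ n ∸ 1 → n ∸ suc s ≡ suc a → n ≡ suc s + suc a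
  split {s} t≤ eq = trans (sym (m+[n∸m]≡n (≤-trans t≤ (m∸n≤m n 1)))) (cong (suc s +_) eq)

  t<n : ∀ {t} → t ≤ n ∸ 1 → t < n
  t<n t≤ = ≤-trans (s≤s t≤) (≤-reflexive (m+[n∸m]≡n 1≤n))

  2≤n : ∀ {t} → 2 ≤ t → t ≤ n ∸ 1 → 2 ≤ n
  2≤n 2≤t t≤ = ≤-trans 2≤t (≤-trans t≤ (m∸n≤m n 1))

  generic : ∀ t → 2 ≤ t → t ≤ n ∸ 1 → (n ∸ t) C 2 + t * (n ∸ t ∸ 1) + n ≤ k →
    k ≤ (n ∸ t) C 2 + t * (n ∸ t) + n ∸ 2 → IsG n k (k ∸ n + t)
  generic (suc s) 2≤t t≤ lower upper with n ∸ suc s in eq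
  ... | zero  = contradiction (t<n t≤) (≤⇒≯ (m∸n≡0⇒m≤n eq))
  -- Moving the truncated `∸ 2` to the other side requires a minuend of at least 2, which its
  -- summand `n` guarantees.
  ... | suc a = isG-generic s a (split t≤ eq) n≤k lower
    (≤-trans (+-monoˡ-≤ 2 upper) (≤-reflexive (m∸n+n≡m (≤-trans (2≤n 2≤t t≤) (m≤n+m n _)))))

  boundary : ∀ t → 2 ≤ t → t ≤ n ∸ 1 → k ≡ (n ∸ t) C 2 + t * (n ∸ t) + n ∸ 1 → IsG n k (k ∸ n + t ∸ 1)
  boundary (suc s) 2≤t t≤ k≡ with n ∸ suc s in eq
  ... | zero  = contradiction (t<n t≤) (≤⇒≯ (m∸n≡0⇒m≤n eq))
  ... | suc a = subst (IsG n k) (sym (cong (_∸ 1) (+-suc (k ∸ n) s))) (isG-boundary s a (split t≤ eq) n≤k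
    (trans (cong (_+ 1) k≡) (m∸n+n≡m (≤-trans 1≤n (m≤n+m n _)))))

  almostComplete : k ≡ n C 2 + n ∸ 1 → IsG n k (n C 2 ∸ 1)
  almostComplete k≡ = isG-almostComplete n≤k (trans (cong (_+ 1) k≡) (m∸n+n≡m (≤-trans 1≤n (m≤n+m n (n C 2)))))
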